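{- Let $A(n)$ denote the number of polyominoes with $n$ cells, where a polyomino is a finite edge-connected set of cells of the square lattice $\mathbb{Z}^2$ and two polyominoes are identified if one is a translate of the other. Let $\lambda = \lim_{n\to\infty} \sqrt[n]{A(n)}$ (Klarner's constant). Then \[ \lambda \le 4.5238. \]
   Context: Cells are unit squares of the square lattice, identified with points of $\mathbb{Z}^2$; two cells are edge-adjacent if their coordinates differ by $1$ in exactly one coordinate. The limit defining $\lambda$ exists. -}

module Defs where

open import Data.Nat as ℕ using (ℕ; zero; suc)
open import Data.Integer as ℤ using (ℤ; +_)
open import Data.Product using (Σ; ∃; ∃-syntax; _×_; _,_)
open import Data.Fin using (Fin)
open import Data.List using (List; length)
open import Data.List.Membership.Propositional using (_∈_)
open import Data.List.Relation.Unary.Unique.Propositional using (Unique)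
open import Data.Sum using (_⊎_)
open import Relation.Binary.PropositionalEquality using (_≡_)
open import Relation.Nullary using (¬_)
open import Function.Bundles using (_⇔_)
open import Data.Rational as ℚ using (ℚ)

Cell : Set
Cell = ℤ × ℤ

data Adj : Cell → Cell → Set where
  adj-x : ∀ {x x' y} → ℤ.∣ x ℤ.- x' ∣ ≡ 1 → Adj (x , y) (x' , y)
  adj-y : ∀ {x y y'} → ℤ.∣ y ℤ.- y' ∣ ≡ 1 → Adj (x , y) (x , y')

-- A finite set of cells, represented by a duplicate-free list.
-- Reach S a b : there is an edge-path from a to b inside S.
data Reach (S : List Cell) : Cell → Cell → Set where
  here : ∀ {a} → a ∈ S → Reach S a a
  step : ∀ {a b c} → Reach S a b → Adj b c → c ∈ S → Reach S a c

EdgeConnected : List Cell → Set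
EdgeConnected S = ∀ {a b} → a ∈ S → b ∈ S → Reach S a b

IsPolyomino : ℕ → List Cell → Set
IsPolyomino n S = Unique S × length S ≡ n × EdgeConnected S

translate : Cell → Cell → Cell
translate (vx , vy) (x , y) = (x ℤ.+ vx , y ℤ.+ vy)

IsTranslate : List Cell → List Cell → Set
IsTranslate S T = ∃[ v ] (∀ c → (c ∈ T) ⇔ (∃[ d ] (d ∈ S × translate v d ≡ c)))

PolyCount : ℕ → ℕ → Set
PolyCount n k =
  Σ (Fin k → List Cell) λ rep →
    (∀ i → IsPolyomino n (rep i)) ×
    (∀ i j → IsTranslate (rep i) (rep j) → i ≡ j) ×
    (∀ S → IsPolyomino n S → ∃[ i ] IsTranslate (rep i) S)

_^ℚ_ : ℚ → ℕ → ℚ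
q ^ℚ zero = ℚ.1ℚ
q ^ℚ suc n = q ℚ.* (q ^ℚ n)

bound : ℚ
bound = + 45238 ℚ./ 10000

{-# OPTIONS --safe #-}
module Submission where

-- A polyomino S is explored from one of its cells.  A state of the exploration is
-- a pair (P , K): P consists of cells of S whose neighbourhood is still of interest,
-- K of further cells already decided.  A branch on an undecided cell c next to P asks
-- whether c belongs to S and has not been claimed yet; either answer enlarges the
-- decided set, after which P may be broken into several smaller states that are
-- treated independently, each one forgetting whatever it likes.  The answers
-- determine S.  If v bounds the generating function Σ x^(number of cells found) of a
-- state, it is enough that v (P , K) ≥ x · Π v (parts after "yes") + Π v (parts after "no").
-- A table of 84 states, closed under branching up to isometry, has a positive solution
-- of these inequalities at x = 1 / 4.5238, so A(n) = O(4.5238ⁿ).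

open import Defs
open import Data.Fin using (Fin)
import Data.Fin.Properties as Fin
open import Data.Integer as ℤ using (+_; +[1+_]; -[1+_]; _⊖_; 0ℤ; 1ℤ)
import Data.Integer.Properties as ℤ
import Data.Integer.Tactic.RingSolver as ℤ
open import Data.List as List using (List; []; _∷_; _++_; length; map; concatMap)
import Data.List.Membership.DecPropositional as DecMembership
open import Data.List.Membership.Propositional using (_∈_; _∉_)
open import Data.List.Membership.Propositional.Properties using (∈-map⁺; ∈-map⁻; ∈-++⁺ˡ; ∈-++⁺ʳ; ∈-++⁻; ∈-∃++; ∈-concatMap⁻)
import Data.List.Properties as List
open import Data.List.Relation.Unary.All as All using (All; []; _∷_; all?)
import Data.List.Relation.Unary.All.Properties as All
open import Data.List.Relation.Unary.Any as Any using (Any; here; there)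
import Data.List.Relation.Unary.Any.Properties as Any
open import Data.Nat as ℕ using (ℕ; zero; suc; _≥_)
import Data.Nat.ListAction as ℕ
import Data.Nat.Properties as ℕ
import Data.Nat.Tactic.RingSolver as ℕ
open import Data.Product using (∃-syntax; _×_; _,_; proj₁; proj₂)
open import Data.Product.Properties using (≡-dec)
open import Data.Rational as ℚ using (ℚ; mkℚ; Positive; _≤_; _+_; _*_; _/_; 0ℚ; 1ℚ; toℚᵘ)
import Data.Rational.Properties as ℚ
open import Data.Rational.Solver using (module +-*-Solver)
open import Data.Rational.Unnormalised as ℚᵘ using (mkℚᵘ; *≡*; *≤*)
import Data.Rational.Unnormalised.Properties as ℚᵘ
open import Data.Sum as Sum using (_⊎_; inj₁; inj₂)
open import Data.Unit using (tt)
open import Function using (_∘_; id; _⇔_; mk⇔; Equivalence)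
open import Relation.Binary.PropositionalEquality
open import Relation.Nullary using (Dec; yes; no; contradiction)
open import Relation.Nullary.Decidable using (_×-dec_; _⊎-dec_; toWitness)

open DecMembership (≡-dec ℤ._≟_ ℤ._≟_) using (_∈?_)

-- Neighbours and isometries of the square lattice.

neighbours : Cell → List Cell
neighbours (x , y) =
  (x ℤ.+ 1ℤ , y) ∷ (x ℤ.- 1ℤ , y) ∷ (x , y ℤ.+ 1ℤ) ∷ (x , y ℤ.- 1ℤ) ∷ []

∣i-j∣≡1⇒ : ∀ i j → ℤ.∣ i ℤ.- j ∣ ≡ 1 → j ≡ i ℤ.+ 1ℤ ⊎ j ≡ i ℤ.- 1ℤ
∣i-j∣≡1⇒ i j eq = Sum.map moved moved (unit (i ℤ.- j) eq)
  where
  unit : ∀ k → ℤ.∣ k ∣ ≡ 1 → k ≡ ℤ.- 1ℤ ⊎ k ≡ 1ℤ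
  unit (+ 1)    refl = inj₂ refl
  unit -[1+ 0 ] refl = inj₁ refl
  i-[i-j]≡j : ∀ i j → j ≡ i ℤ.- (i ℤ.- j)
  i-[i-j]≡j = ℤ.solve-∀
  moved : ∀ {k} → i ℤ.- j ≡ k → j ≡ i ℤ.- k
  moved refl = i-[i-j]≡j i j

Adj⇒∈neighbours : ∀ {a b} → Adj a b → b ∈ neighbours a
Adj⇒∈neighbours (adj-x {x} {x′} eq) with ∣i-j∣≡1⇒ x x′ eq
... | inj₁ refl = here refl
... | inj₂ refl = there (here refl)
Adj⇒∈neighbours (adj-y {x} {y} {y′} eq) with ∣i-j∣≡1⇒ y y′ eq
... | inj₁ refl = there (there (here refl))
... | inj₂ refl = there (there (there (here refl)))

-- The property of a lattice isometry used by the exploration: if all neighbours of a cell in the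
-- table are decided, so are all neighbours of its placed copy.
LiftsNeighbours : (Cell → Cell) → Set
LiftsNeighbours φ = ∀ a {b} → b ∈ neighbours (φ a) → b ∈ map φ (neighbours a)

∘-lifts : ∀ φ {ψ} → LiftsNeighbours φ → LiftsNeighbours ψ → LiftsNeighbours (φ ∘ ψ)
∘-lifts φ {ψ} liftφ liftψ a b∈ with ∈-map⁻ φ (liftφ (ψ a) b∈)
... | b′ , b′∈ , refl with ∈-map⁻ ψ (liftψ a b′∈)
...   | b″ , b″∈ , refl = ∈-map⁺ (φ ∘ ψ) b″∈

id-lifts : LiftsNeighbours id
id-lifts a b∈ = ∈-map⁺ id b∈

≡⇒lifts : ∀ {φ} → (∀ a → neighbours (φ a) ≡ map φ (neighbours a)) → LiftsNeighbours φ
≡⇒lifts eq a {b} = subst (b ∈_) (eq a)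

translate-lifts : ∀ v → LiftsNeighbours (translate v)
translate-lifts (vx , vy) = ≡⇒lifts λ (x , y) →
  cong₂ (λ p q → (p , y ℤ.+ vy) ∷ q) (up x vx)
  (cong₂ (λ p q → (p , y ℤ.+ vy) ∷ q) (down x vx)
  (cong₂ (λ p q → (x ℤ.+ vx , p) ∷ (x ℤ.+ vx , q) ∷ []) (up y vy) (down y vy)))
  where
  up : ∀ i v → i ℤ.+ v ℤ.+ 1ℤ ≡ i ℤ.+ 1ℤ ℤ.+ v
  up = ℤ.solve-∀
  down : ∀ i v → i ℤ.+ v ℤ.- 1ℤ ≡ i ℤ.- 1ℤ ℤ.+ v
  down = ℤ.solve-∀

flipX swap : Cell → Cell
flipX (x , y) = ℤ.- x , y
swap (x , y) = y , x

swap-lifts : LiftsNeighbours swap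
swap-lifts a (here refl)                         = there (there (here refl))
swap-lifts a (there (here refl))                 = there (there (there (here refl)))
swap-lifts a (there (there (here refl)))         = here refl
swap-lifts a (there (there (there (here refl)))) = there (here refl)

flipX-lifts : LiftsNeighbours flipX
flipX-lifts (x , y) (here refl)                         = there (here (cong (_, y) (eq x)))
  where
  eq : ∀ i → ℤ.- i ℤ.+ 1ℤ ≡ ℤ.- (i ℤ.- 1ℤ)
  eq = ℤ.solve-∀
flipX-lifts (x , y) (there (here refl))                 = here (cong (_, y) (eq x))
  where
  eq : ∀ i → ℤ.- i ℤ.- 1ℤ ≡ ℤ.- (i ℤ.+ 1ℤ)
  eq = ℤ.solve-∀
flipX-lifts (x , y) (there (there (here refl)))         = there (there (here refl))
flipX-lifts (x , y) (there (there (there (here refl)))) = there (there (there (here refl)))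

-- `swap ∘ flipX` is the quarter turn taking (x , y) to (y , -x).
rotate : ℕ → Cell → Cell
rotate zero    = id
rotate (suc k) = swap ∘ flipX ∘ rotate k

rotate-lifts : ∀ k → LiftsNeighbours (rotate k)
rotate-lifts zero    = id-lifts
rotate-lifts (suc k) = ∘-lifts swap swap-lifts (∘-lifts flipX flipX-lifts (rotate-lifts k))

-- The symmetries of the square: 0 to 3 are the rotations, 4 to 7 the reflections; larger numbers
-- repeat the reflections.
symmetry : ℕ → Cell → Cell
symmetry (suc (suc (suc (suc k)))) = rotate k ∘ swap
symmetry k                         = rotate k

symmetry-lifts : ∀ k → LiftsNeighbours (symmetry k)
symmetry-lifts 0 = rotate-lifts 0
symmetry-lifts 1 = rotate-lifts 1
symmetry-lifts 2 = rotate-lifts 2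
symmetry-lifts 3 = rotate-lifts 3
symmetry-lifts (suc (suc (suc (suc k)))) = ∘-lifts (rotate k) (rotate-lifts k) swap-lifts

-- Normalising polyominoes up to translation.

origin : Cell
origin = 0ℤ , 0ℤ

negate : Cell → Cell
negate (x , y) = ℤ.- x , ℤ.- y

-- The result depends on which cell is listed first. This does no harm: it only has to separate
-- lists that are not translates of each other.
recentre : List Cell → List Cell
recentre []        = []
recentre S@(r ∷ _) = map (translate (negate r)) S

base : List Cell → Cell
base []      = origin
base (r ∷ _) = r

recentre≡ : ∀ S → recentre S ≡ map (translate (negate (base S))) S
recentre≡ []      = refl
recentre≡ (_ ∷ _) = refl

translate-negate : ∀ r → translate (negate r) r ≡ origin
translate-negate (x , y) = cong₂ _,_ (ℤ.+-inverseʳ x) (ℤ.+-inverseʳ y)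

[i+k]-[j+k]≡i-j : ∀ i j k → (i ℤ.+ k) ℤ.- (j ℤ.+ k) ≡ i ℤ.- j
[i+k]-[j+k]≡i-j = ℤ.solve-∀

Adj-translate : ∀ v {a b} → Adj a b → Adj (translate v a) (translate v b)
Adj-translate (vx , vy) (adj-x {x} {x′} eq)     = adj-x (trans (cong ℤ.∣_∣ ([i+k]-[j+k]≡i-j x x′ vx)) eq)
Adj-translate (vx , vy) (adj-y {x} {y} {y′} eq) = adj-y (trans (cong ℤ.∣_∣ ([i+k]-[j+k]≡i-j y y′ vy)) eq)

Reach-translate : ∀ v {S a b} → Reach S a b → Reach (map (translate v) S) (translate v a) (translate v b)
Reach-translate v (here a∈)          = here (∈-map⁺ (translate v) a∈)
Reach-translate v (step path adj c∈) =
  step (Reach-translate v path) (Adj-translate v adj) (∈-map⁺ (translate v) c∈)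

-- The vector sought is the difference j - i of the two base cells.
displacement : ∀ i j c d → translate (negate j) c ≡ translate (negate i) d →
  translate (translate j (negate i)) d ≡ c
displacement (ix , iy) (jx , jy) (cx , cy) (dx , dy) eq =
  cong₂ _,_ (solved ix jx cx dx (cong proj₁ eq)) (solved iy jy cy dy (cong proj₂ eq))
  where
  regroup : ∀ i j d → d ℤ.+ (ℤ.- i ℤ.+ j) ≡ d ℤ.+ ℤ.- i ℤ.+ j
  regroup = ℤ.solve-∀
  cancel : ∀ c j → c ℤ.+ ℤ.- j ℤ.+ j ≡ c
  cancel = ℤ.solve-∀
  solved : ∀ i j c d → c ℤ.+ ℤ.- j ≡ d ℤ.+ ℤ.- i → d ℤ.+ (ℤ.- i ℤ.+ j) ≡ c
  solved i j c d e = trans (regroup i j d) (trans (cong (ℤ._+ j) (sym e)) (cancel c j))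

recentre-translate : ∀ S T → (∀ c → c ∈ recentre S ⇔ c ∈ recentre T) → IsTranslate S T
recentre-translate S T same rewrite recentre≡ S | recentre≡ T = v , λ c → mk⇔ (to c) (from c)
  where
  σ = translate (negate (base S))
  τ = translate (negate (base T))
  v = translate (base T) (negate (base S))
  to : ∀ c → c ∈ T → ∃[ d ] (d ∈ S × translate v d ≡ c)
  to c c∈ with ∈-map⁻ σ (Equivalence.from (same (τ c)) (∈-map⁺ τ c∈))
  ... | d , d∈ , eq = d , d∈ , displacement (base S) (base T) c d eq
  from : ∀ c → ∃[ d ] (d ∈ S × translate v d ≡ c) → c ∈ T
  from c (d , d∈ , refl) with ∈-map⁻ τ (Equivalence.to (same (σ d)) (∈-map⁺ σ d∈))
  ... | c′ , c′∈ , eq = subst (_∈ T) (sym (displacement (base S) (base T) c′ d (sym eq))) c′∈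

-- Rational estimates

fromℕ : ℕ → ℚ
fromℕ n = + n / 1

toℚᵘ-fromℕ : ∀ n → toℚᵘ (fromℕ n) ℚᵘ.≃ mkℚᵘ (+ n) 0
toℚᵘ-fromℕ n = ℚ.toℚᵘ-fromℚᵘ (mkℚᵘ (+ n) 0)

toℚᵘ-fromℕ-* : ∀ n r → toℚᵘ (fromℕ n * r) ℚᵘ.≃ mkℚᵘ (+ n) 0 ℚᵘ.* toℚᵘ r
toℚᵘ-fromℕ-* n r = ℚᵘ.≃-trans (ℚ.toℚᵘ-homo-* (fromℕ n) r) (ℚᵘ.*-congʳ (toℚᵘ-fromℕ n))

fromℕ-mono-≤ : ∀ {m n} → m ℕ.≤ n → fromℕ m ≤ fromℕ n
fromℕ-mono-≤ {m} {n} m≤n = ℚ.toℚᵘ-cancel-≤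
  (ℚᵘ.≤-respˡ-≃ (ℚᵘ.≃-sym (toℚᵘ-fromℕ m)) (ℚᵘ.≤-respʳ-≃ (ℚᵘ.≃-sym (toℚᵘ-fromℕ n))
    (*≤* (ℤ.*-monoʳ-≤-nonNeg (+ 1) (ℤ.+≤+ m≤n)))))

fromℕ-* : ∀ m n → fromℕ (m ℕ.* n) ≡ fromℕ m * fromℕ n
fromℕ-* m n = ℚ.toℚᵘ-injective (ℚᵘ.≃-trans (toℚᵘ-fromℕ (m ℕ.* n)) (ℚᵘ.≃-trans
  (*≡* (cong (ℤ._* + 1) (ℤ.pos-* m n)))
  (ℚᵘ.≃-sym (ℚᵘ.≃-trans (toℚᵘ-fromℕ-* m (fromℕ n)) (ℚᵘ.*-congˡ {mkℚᵘ (+ m) 0} (toℚᵘ-fromℕ n))))))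

fromℕ-suc : ∀ n → fromℕ (suc n) ≡ 1ℚ + fromℕ n
fromℕ-suc n = ℚ.toℚᵘ-injective (ℚᵘ.≃-trans (toℚᵘ-fromℕ (suc n)) (ℚᵘ.≃-trans
  (*≡* (cong (λ k → (+ 1 ℤ.+ k) ℤ.* + 1) (sym (ℤ.*-identityʳ (+ n)))))
  (ℚᵘ.≃-sym (ℚᵘ.≃-trans (ℚ.toℚᵘ-homo-+ 1ℚ (fromℕ n)) (ℚᵘ.+-congʳ (toℚᵘ 1ℚ) (toℚᵘ-fromℕ n))))))

fromℕ-^ : ∀ m n → fromℕ (m ℕ.^ n) ≡ fromℕ m ^ℚ n
fromℕ-^ m zero    = refl
fromℕ-^ m (suc n) = trans (fromℕ-* m (m ℕ.^ n)) (cong (fromℕ m *_) (fromℕ-^ m n))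

archimedean : ∀ δ → Positive δ → ∀ m → ∃[ N ] fromℕ m ≤ fromℕ N * δ
-- With δ = (a + 1) / (b + 1) the witness N = m (b + 1) gives N δ = m (a + 1), which is at least m.
archimedean δ@(mkℚ +[1+ a ] b _) _ m = m ℕ.* suc b , ℚ.toℚᵘ-cancel-≤
  (ℚᵘ.≤-respˡ-≃ (ℚᵘ.≃-sym (toℚᵘ-fromℕ m)) (ℚᵘ.≤-respʳ-≃ (ℚᵘ.≃-sym (toℚᵘ-fromℕ-* (m ℕ.* suc b) δ))
    (*≤* (subst₂ ℤ._≤_ (trans (ℤ.pos-* m (suc b)) (cong (λ d → + m ℤ.* + suc d) (sym (ℕ.+-identityʳ b))))
      (trans (ℤ.pos-* (m ℕ.* suc b) (suc a)) (sym (ℤ.*-identityʳ _)))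
      (ℤ.+≤+ (ℕ.m≤m*n (m ℕ.* suc b) (suc a)))))))

^-pos : ∀ r n → Positive r → Positive (r ^ℚ n)
^-pos r zero    _     = _
^-pos r (suc n) r-pos = ℚ.pos*pos⇒pos r {{r-pos}} (r ^ℚ n) {{^-pos r n r-pos}}

^-distrib-* : ∀ r s n → (r * s) ^ℚ n ≡ r ^ℚ n * s ^ℚ n
^-distrib-* r s zero    = refl
^-distrib-* r s (suc n) = trans (cong (r * s *_) (^-distrib-* r s n))
  (solve 4 (λ r s x y → r :* s :* (x :* y) := r :* x :* (s :* y)) refl r s (r ^ℚ n) (s ^ℚ n))
  where open +-*-Solver

-- Induction on n. The increment δ · 1 is enlarged to δ (1 + δ)^n, since the induction hypothesis
-- itself gives 1 ≤ (1 + δ)^n.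
bernoulli : ∀ δ → Positive δ → ∀ n → 1ℚ + fromℕ n * δ ≤ (1ℚ + δ) ^ℚ n
bernoulli δ pos zero    = ℚ.≤-reflexive (trans (cong (λ z → 1ℚ + z) (ℚ.*-zeroˡ δ)) (ℚ.+-identityʳ 1ℚ))
bernoulli δ pos (suc n) = begin
  1ℚ + fromℕ (suc n) * δ                  ≡⟨ cong (λ k → 1ℚ + k * δ) (fromℕ-suc n) ⟩
  1ℚ + (1ℚ + fromℕ n) * δ                 ≡⟨ solve 2 (λ k d →
    con 1ℚ :+ (con 1ℚ :+ k) :* d := con 1ℚ :+ k :* d :+ d :* con 1ℚ) refl (fromℕ n) δ ⟩
  1ℚ + fromℕ n * δ + δ * 1ℚ               ≤⟨ ℚ.+-mono-≤ ih (ℚ.*-monoˡ-≤-nonNeg δ (ℚ.≤-trans 1≤ ih)) ⟩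
  (1ℚ + δ) ^ℚ n + δ * (1ℚ + δ) ^ℚ n       ≡⟨ solve 2 (λ d x →
    x :+ d :* x := (con 1ℚ :+ d) :* x) refl δ ((1ℚ + δ) ^ℚ n) ⟩
  (1ℚ + δ) * (1ℚ + δ) ^ℚ n                ∎
  where
  open ℚ.≤-Reasoning
  open +-*-Solver
  instance
    _ : ℚ.NonNegative δ
    _ = ℚ.pos⇒nonNeg δ {{pos}}
  ih = bernoulli δ pos n
  1≤ : 1ℚ ≤ 1ℚ + fromℕ n * δ
  1≤ = subst₂ _≤_ (trans (cong (λ z → 1ℚ + z) (ℚ.*-zeroˡ δ)) (ℚ.+-identityʳ 1ℚ)) refl
         (ℚ.+-monoʳ-≤ 1ℚ (ℚ.*-monoʳ-≤-nonNeg δ (fromℕ-mono-≤ {0} {n} ℕ.z≤n)))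

-- Write μ + ε = (1 + δ) μ with δ = ε / μ; by Bernoulli's inequality and the Archimedean property (1
-- + δ)^n is eventually at least V.
absorb-constant : ∀ μ → Positive μ → ∀ ε → Positive ε → ∀ V →
  ∃[ N ] (∀ n → n ≥ N → fromℕ V * μ ^ℚ n ≤ (μ + ε) ^ℚ n)
absorb-constant μ μ-pos ε ε-pos V = N , λ n n≥N → begin
  fromℕ V * μ ^ℚ n             ≤⟨ ℚ.*-monoʳ-≤-nonNeg (μ ^ℚ n)
                                    {{ℚ.pos⇒nonNeg (μ ^ℚ n) {{^-pos μ n μ-pos}}}} (V≤ n n≥N) ⟩
  (1ℚ + δ) ^ℚ n * μ ^ℚ n       ≡⟨ ^-distrib-* (1ℚ + δ) μ n ⟨
  ((1ℚ + δ) * μ) ^ℚ n          ≡⟨ cong (_^ℚ n) rescale ⟩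
  (μ + ε) ^ℚ n                 ∎
  where
  open ℚ.≤-Reasoning
  instance
    _ : ℚ.NonZero μ
    _ = ℚ.pos⇒nonZero μ {{μ-pos}}
  δ = ε * ℚ.1/ μ
  δ-pos : Positive δ
  δ-pos = ℚ.pos*pos⇒pos ε {{ε-pos}} (ℚ.1/ μ) {{ℚ.1/pos⇒pos μ {{μ-pos}}}}
  arch = archimedean δ δ-pos V
  N = proj₁ arch
  rescale : (1ℚ + δ) * μ ≡ μ + ε
  rescale = trans (solve 3 (λ m e i → (con 1ℚ :+ e :* i) :* m := m :+ e :* (i :* m)) refl μ ε (ℚ.1/ μ))
    (cong (λ z → μ + z) (trans (cong (ε *_) (ℚ.*-inverseˡ μ)) (ℚ.*-identityʳ ε)))
    where open +-*-Solver
  V≤ : ∀ n → n ≥ N → fromℕ V ≤ (1ℚ + δ) ^ℚ n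
  V≤ n n≥N = begin
    fromℕ V              ≤⟨ proj₂ arch ⟩
    fromℕ N * δ          ≤⟨ ℚ.*-monoʳ-≤-nonNeg δ {{ℚ.pos⇒nonNeg δ {{δ-pos}}}} (fromℕ-mono-≤ n≥N) ⟩
    fromℕ n * δ          ≡⟨ ℚ.+-identityˡ _ ⟨
    0ℚ + fromℕ n * δ     ≤⟨ ℚ.+-monoˡ-≤ (fromℕ n * δ) (ℚ.nonNegative⁻¹ 1ℚ) ⟩
    1ℚ + fromℕ n * δ     ≤⟨ bernoulli δ δ-pos n ⟩
    (1ℚ + δ) ^ℚ n        ∎

-- Passes from the count, which is carried out in natural numbers, to the rational rate μ = p / q by
-- cancelling q^n.
clear-denominator : ∀ μ q p → Positive (fromℕ q) → μ * fromℕ q ≡ fromℕ p → ∀ n a V →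
  a ℕ.* q ℕ.^ n ℕ.≤ V ℕ.* p ℕ.^ n → fromℕ a ≤ fromℕ V * μ ^ℚ n
clear-denominator μ q p q-pos μq≡p n a V h =
  ℚ.*-cancelʳ-≤-pos (fromℕ q ^ℚ n) {{^-pos (fromℕ q) n q-pos}} (begin
    fromℕ a * fromℕ q ^ℚ n               ≡⟨ cong (fromℕ a *_) (fromℕ-^ q n) ⟨
    fromℕ a * fromℕ (q ℕ.^ n)            ≡⟨ fromℕ-* a (q ℕ.^ n) ⟨
    fromℕ (a ℕ.* q ℕ.^ n)                ≤⟨ fromℕ-mono-≤ h ⟩
    fromℕ (V ℕ.* p ℕ.^ n)                ≡⟨ trans (fromℕ-* V (p ℕ.^ n)) (cong (fromℕ V *_) (fromℕ-^ p n)) ⟩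
    fromℕ V * fromℕ p ^ℚ n               ≡⟨ cong (λ z → fromℕ V * z ^ℚ n) μq≡p ⟨
    fromℕ V * (μ * fromℕ q) ^ℚ n         ≡⟨ cong (fromℕ V *_) (^-distrib-* μ (fromℕ q) n) ⟩
    fromℕ V * (μ ^ℚ n * fromℕ q ^ℚ n)    ≡⟨ ℚ.*-assoc (fromℕ V) _ _ ⟨
    fromℕ V * μ ^ℚ n * fromℕ q ^ℚ n      ∎)
  where open ℚ.≤-Reasoning

-- States

-- The state number `index` of the table, moved by the isometry numbered `isometry`
-- and then translated by (shiftX - 1 , shiftY - 1).
record Part : Set where
  constructor part
  field
    index    : ℕ
    isometry : ℕ
    shiftX   : ℕ
    shiftY   : ℕ

place : Part → Cell → Cell
place (part _ g a b) = translate (a ⊖ 1 , b ⊖ 1) ∘ symmetry g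

place-lifts : ∀ q → LiftsNeighbours (place q)
place-lifts (part _ g a b) =
  ∘-lifts (translate (a ⊖ 1 , b ⊖ 1)) (translate-lifts _) (symmetry-lifts g)

-- In the notation (P , K) above, `active` is P, `known` is K and `target` is the cell
-- branched on.  The bound v on the generating function is value / scale.  Ranks make the
-- exploration terminate: a rejection lowers the total rank, and an acceptance
-- raises it by less than `bonus`.
record Node : Set where
  constructor node
  field
    active : List Cell
    known  : List Cell
    target : Cell
    value  : ℕ
    rank   : ℕ
    accept : List Part
    reject : List Part

  decided : List Cell
  decided = active ++ known

-- The growth rate to be proved is p / q.
record Parameters : Set where
  field
    lookup    : ℕ → Node
    p q scale : ℕ
    bonus     : ℕ

module Conditions (Π : Parameters) where
  open Parameters Π

  child : Part → Node
  child = lookup ∘ Part.index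

  values ranks : List Part → ℕ
  values = ℕ.product ∘ map (Node.value ∘ child)
  ranks  = ℕ.sum ∘ map (Node.rank ∘ child)

  scales : List Part → ℕ
  scales qs = scale ℕ.^ length qs

  activeImage : Part → List Cell
  activeImage r = map (place r) (Node.active (child r))

  -- A part may forget decisions but never assumes one that was not made.
  DecidedIn : List Cell → Part → Set
  DecidedIn A r = All (λ a → place r a ∈ A) (Node.decided (child r))

  -- An active cell may be dropped once its neighbours are all decided, since nothing new can be
  -- found from it.
  Handled : List Cell → List Part → Cell → Set
  Handled A rs p = p ∈ concatMap activeImage rs ⊎ All (_∈ A) (neighbours p)

  Covers : List Cell → List Cell → List Part → Set
  Covers P A rs = All (DecidedIn A) rs × All (Handled A rs) P

  -- In terms of the real bounds the inequality reads (q / p) va + vr ≤ v.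
  Good : Node → Set
  Good n =
    Covers (target ∷ active) (target ∷ decided) accept ×
    Covers active (target ∷ decided) reject ×
    q ℕ.* values accept ℕ.* scale ℕ.* scales reject ℕ.+ p ℕ.* values reject ℕ.* scale ℕ.* scales accept
      ℕ.≤ p ℕ.* value ℕ.* scales accept ℕ.* scales reject ×
    ranks accept ℕ.< rank ℕ.+ bonus ×
    ranks reject ℕ.< rank
    where open Node n

  covers? : ∀ P A rs → Dec (Covers P A rs)
  covers? P A rs =
    all? (λ r → all? (λ a → place r a ∈? A) _) rs ×-dec
    all? (λ p → (p ∈? _) ⊎-dec all? (_∈? A) _) P

  good? : ∀ n → Dec (Good n)
  good? n =
    covers? _ _ _ ×-dec covers? _ _ _ ×-dec (_ ℕ.≤? _) ×-dec (_ ℕ.<? _) ×-dec (_ ℕ.<? _)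

-- Exploration of a polyomino

module Exploration (Π : Parameters) (good : ∀ i → Conditions.Good Π (Parameters.lookup Π i)) where
  open Parameters Π
  open Conditions Π

  good-value : ∀ i → let open Node (lookup i) in
    q ℕ.* values accept ℕ.* scale ℕ.* scales reject ℕ.+ p ℕ.* values reject ℕ.* scale ℕ.* scales accept
      ℕ.≤ p ℕ.* value ℕ.* scales accept ℕ.* scales reject
  good-value i = proj₁ (proj₂ (proj₂ (good i)))

  good-accept-rank : ∀ i → let open Node (lookup i) in ranks accept ℕ.< rank ℕ.+ bonus
  good-accept-rank i = proj₁ (proj₂ (proj₂ (proj₂ (good i))))

  good-reject-rank : ∀ i → let open Node (lookup i) in ranks reject ℕ.< rank
  good-reject-rank i = proj₂ (proj₂ (proj₂ (proj₂ (good i))))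

  -- A state of the table with the accumulated isometry that carries it to its place in the
  -- polyomino.
  Item : Set
  Item = ℕ × (Cell → Cell)

  locate : (Cell → Cell) → List Part → List Item
  locate φ = map (λ r → Part.index r , φ ∘ place r)

  accepted rejected : Item → List Item
  accepted (i , φ) = locate φ (Node.accept (lookup i))
  rejected (i , φ) = locate φ (Node.reject (lookup i))

  query : Item → Cell
  query (i , φ) = φ (Node.target (lookup i))

  -- All sets of claimed cells that a run on the given stack with at most k acceptances
  -- and at most f branchings can lead to, starting from D.
  outcomes : ℕ → List Item → ℕ → List Cell → List (List Cell)
  outcomes f       []       k       D = D ∷ []
  -- Runs out of fuel are discarded; `exhibit` shows that the runs which matter have enough.
  outcomes zero    (_ ∷ _)  k       D = []
  outcomes (suc f) (t ∷ st) zero    D = outcomes f (rejected t ++ st) zero D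
  outcomes (suc f) (t ∷ st) (suc k) D =
    outcomes f (accepted t ++ st) k (query t ∷ D) ++ outcomes f (rejected t ++ st) (suc k) D

  -- Bounding the number of outcomes.

  stackValue stackScale stackRank : List Item → ℕ
  stackValue = ℕ.product ∘ map (Node.value ∘ lookup ∘ proj₁)
  stackScale st = scale ℕ.^ length st
  stackRank  = ℕ.sum ∘ map (Node.rank ∘ lookup ∘ proj₁)

  stackValue-locate : ∀ φ rs st → stackValue (locate φ rs ++ st) ≡ values rs ℕ.* stackValue st
  stackValue-locate φ []       st = sym (ℕ.*-identityˡ _)
  stackValue-locate φ (r ∷ rs) st =
    trans (cong (w ℕ.*_) (stackValue-locate φ rs st)) (sym (ℕ.*-assoc w (values rs) (stackValue st)))
    where w = Node.value (child r)

  stackScale-locate : ∀ φ rs st → stackScale (locate φ rs ++ st) ≡ scales rs ℕ.* stackScale st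
  stackScale-locate φ []       st = sym (ℕ.*-identityˡ _)
  stackScale-locate φ (r ∷ rs) st =
    trans (cong (scale ℕ.*_) (stackScale-locate φ rs st)) (sym (ℕ.*-assoc scale (scales rs) (stackScale st)))

  stackRank-locate : ∀ φ rs st → stackRank (locate φ rs ++ st) ≡ ranks rs ℕ.+ stackRank st
  stackRank-locate φ []       st = refl
  stackRank-locate φ (r ∷ rs) st =
    trans (cong (w ℕ.+_) (stackRank-locate φ rs st)) (sym (ℕ.+-assoc w (ranks rs) (stackRank st)))
    where w = Node.rank (child r)

  module _ {{_ : ℕ.NonZero scale}} (q≤p : q ℕ.≤ p) where

    -- Both sides are multiplied by the scales of all parts, which turns the claim into
    -- the inequality required of a node.
    combine : ∀ i Q P l₁ l₂ v s → let open Node (lookup i) in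
      l₁ ℕ.* (Q ℕ.* (scales accept ℕ.* s)) ℕ.≤ values accept ℕ.* v ℕ.* P →
      l₂ ℕ.* (q ℕ.* Q ℕ.* (scales reject ℕ.* s)) ℕ.≤ values reject ℕ.* v ℕ.* (p ℕ.* P) →
      (l₁ ℕ.+ l₂) ℕ.* (q ℕ.* Q ℕ.* (scale ℕ.* s)) ℕ.≤ value ℕ.* v ℕ.* (p ℕ.* P)
    combine i Q P l₁ l₂ v s h₁ h₂ =
      ℕ.*-cancelʳ-≤ _ _ (sa ℕ.* sr) (begin
        (l₁ ℕ.+ l₂) ℕ.* (q ℕ.* Q ℕ.* (scale ℕ.* s)) ℕ.* (sa ℕ.* sr)
          ≡⟨ expand l₁ l₂ q Q scale s sa sr ⟩
        l₁ ℕ.* (Q ℕ.* (sa ℕ.* s)) ℕ.* (q ℕ.* scale ℕ.* sr) ℕ.+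
          l₂ ℕ.* (q ℕ.* Q ℕ.* (sr ℕ.* s)) ℕ.* (scale ℕ.* sa)
          ≤⟨ ℕ.+-mono-≤ (ℕ.*-monoˡ-≤ _ h₁) (ℕ.*-monoˡ-≤ _ h₂) ⟩
        va ℕ.* v ℕ.* P ℕ.* (q ℕ.* scale ℕ.* sr) ℕ.+ vr ℕ.* v ℕ.* (p ℕ.* P) ℕ.* (scale ℕ.* sa)
          ≡⟨ collect va vr v P q p scale sa sr ⟩
        v ℕ.* P ℕ.* (q ℕ.* va ℕ.* scale ℕ.* sr ℕ.+ p ℕ.* vr ℕ.* scale ℕ.* sa)
          ≤⟨ ℕ.*-monoʳ-≤ (v ℕ.* P) (good-value i) ⟩
        v ℕ.* P ℕ.* (p ℕ.* value ℕ.* sa ℕ.* sr)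
          ≡⟨ reorder v P p value sa sr ⟩
        value ℕ.* v ℕ.* (p ℕ.* P) ℕ.* (sa ℕ.* sr) ∎)
      where
      open Node (lookup i)
      open ℕ.≤-Reasoning
      sa = scales accept
      sr = scales reject
      va = values accept
      vr = values reject
      instance
        _ : ℕ.NonZero (sa ℕ.* sr)
        _ = ℕ.m*n≢0 sa sr {{ℕ.m^n≢0 scale (length accept)}} {{ℕ.m^n≢0 scale (length reject)}}
      expand : ∀ l₁ l₂ q Q c s sa sr →
        (l₁ ℕ.+ l₂) ℕ.* (q ℕ.* Q ℕ.* (c ℕ.* s)) ℕ.* (sa ℕ.* sr) ≡
        l₁ ℕ.* (Q ℕ.* (sa ℕ.* s)) ℕ.* (q ℕ.* c ℕ.* sr) ℕ.+ l₂ ℕ.* (q ℕ.* Q ℕ.* (sr ℕ.* s)) ℕ.* (c ℕ.* sa)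
      expand = ℕ.solve-∀
      collect : ∀ va vr v P q p c sa sr →
        va ℕ.* v ℕ.* P ℕ.* (q ℕ.* c ℕ.* sr) ℕ.+ vr ℕ.* v ℕ.* (p ℕ.* P) ℕ.* (c ℕ.* sa) ≡
        v ℕ.* P ℕ.* (q ℕ.* va ℕ.* c ℕ.* sr ℕ.+ p ℕ.* vr ℕ.* c ℕ.* sa)
      collect = ℕ.solve-∀
      reorder : ∀ v P p w sa sr →
        v ℕ.* P ℕ.* (p ℕ.* w ℕ.* sa ℕ.* sr) ≡ w ℕ.* v ℕ.* (p ℕ.* P) ℕ.* (sa ℕ.* sr)
      reorder = ℕ.solve-∀

    bound-located : ∀ f k φ rs st D →
      length (outcomes f (locate φ rs ++ st) k D) ℕ.* (q ℕ.^ suc k ℕ.* (scales rs ℕ.* stackScale st))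
        ℕ.≤ values rs ℕ.* stackValue st ℕ.* p ℕ.^ suc k

    -- An outcome with at most k acceptances has weight at least (q / p)^k, so a bound on the
    -- generating function bounds the number of outcomes. The exponent `suc k` makes the case of no
    -- acceptance left an instance of `combine` as well, with l₁ = 0.
    length-outcomes : ∀ f st k D →
      length (outcomes f st k D) ℕ.* (q ℕ.^ suc k ℕ.* stackScale st) ℕ.≤ stackValue st ℕ.* p ℕ.^ suc k
    length-outcomes f [] k D =
      subst₂ ℕ._≤_ (unit (q ℕ.^ suc k)) (sym (ℕ.*-identityˡ (p ℕ.^ suc k))) (ℕ.^-monoˡ-≤ (suc k) q≤p)
      where
      unit : ∀ m → m ≡ 1 ℕ.* (m ℕ.* 1)
      unit = ℕ.solve-∀
    length-outcomes zero (_ ∷ _) k D = ℕ.z≤n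
    length-outcomes (suc f) (t@(i , φ) ∷ st) zero D =
      combine i 1 1 0 (length (outcomes f (rejected t ++ st) 0 D)) (stackValue st) (stackScale st) ℕ.z≤n
        (bound-located f 0 φ (Node.reject (lookup i)) st D)
    length-outcomes (suc f) (t@(i , φ) ∷ st) (suc k) D
      rewrite List.length-++ (outcomes f (accepted t ++ st) k (query t ∷ D)) {outcomes f (rejected t ++ st) (suc k) D} =
      combine i (q ℕ.^ suc k) (p ℕ.^ suc k)
        (length (outcomes f (accepted t ++ st) k (query t ∷ D))) (length (outcomes f (rejected t ++ st) (suc k) D))
        (stackValue st) (stackScale st)
        (bound-located f k φ (Node.accept (lookup i)) st (query t ∷ D))
        (bound-located f (suc k) φ (Node.reject (lookup i)) st D)

    bound-located f k φ rs st D =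
      subst₂ (λ s v → length (outcomes f (locate φ rs ++ st) k D) ℕ.* (q ℕ.^ suc k ℕ.* s) ℕ.≤ v ℕ.* p ℕ.^ suc k)
        (stackScale-locate φ rs st) (stackValue-locate φ rs st)
        (length-outcomes f (locate φ rs ++ st) k D)

  -- Every polyomino is an outcome.

  module _ {S : List Cell} {root : Cell} (reach : ∀ {c} → c ∈ S → Reach S root c) where

    Done : List Cell → Cell → Set
    Done D d = ∀ {b} → b ∈ neighbours d → b ∈ S → b ∈ D

    -- A negative answer means that the cell is outside S or was claimed before, so either answer
    -- establishes this implication.
    Known : List Cell → (Cell → Cell) → List Cell → Set
    Known D φ A = ∀ {a} → a ∈ A → φ a ∈ S → φ a ∈ D

    Located : List Cell → Item → Set
    Located D (i , φ) = LiftsNeighbours φ × Known D φ (Node.decided (lookup i))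

    Active : Cell → Item → Set
    Active d (i , φ) = d ∈ map φ (Node.active (lookup i))

    -- D are the cells claimed so far, rem the remaining cells of S.
    record Invariant (st : List Item) (rem D : List Cell) : Set where
      field
        root∈D   : root ∈ D
        D⊆S      : ∀ {c} → c ∈ D → c ∈ S
        rem⊆S    : ∀ {c} → c ∈ rem → c ∈ S
        S⊆D∪rem  : ∀ {c} → c ∈ S → c ∈ D ⊎ c ∈ rem
        located  : All (Located D) st
        frontier : ∀ {d} → d ∈ D → Done D d ⊎ Any (Active d) st

    closed⇒S⊆D : ∀ {D} → root ∈ D → (∀ {d} → d ∈ D → Done D d) → ∀ {c} → Reach S root c → c ∈ D
    closed⇒S⊆D root∈D done (here _) = root∈D
    closed⇒S⊆D root∈D done (step path adj c∈S) =
      done (closed⇒S⊆D root∈D done path) (Adj⇒∈neighbours adj) c∈S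

    locate-located : ∀ {D φ A rs} → LiftsNeighbours φ → Known D φ A → All (DecidedIn A) rs →
      All (Located D) (locate φ rs)
    locate-located lift known [] = []
    locate-located {φ = φ} {rs = r ∷ _} lift known (inA ∷ ins) =
      (∘-lifts φ lift (place-lifts r) , λ a∈ → known (All.lookup inA a∈)) ∷ locate-located lift known ins

    locate-active : ∀ φ rs {p} → p ∈ concatMap activeImage rs → Any (Active (φ p)) (locate φ rs)
    locate-active φ rs p∈ = Any.map⁺ (Any.map (λ {r} → image r) (∈-concatMap⁻ activeImage {xs = rs} p∈))
      where
      image : ∀ r {p} → p ∈ activeImage r → Active (φ p) (Part.index r , φ ∘ place r)
      image r p∈ with ∈-map⁻ (place r) p∈
      ... | a , a∈ , refl = ∈-map⁺ (φ ∘ place r) a∈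

    -- If p stays active in a part, its image is active there. Otherwise every neighbour of φ p is,
    -- by `lift`, the image of a decided cell, hence claimed if it lies in S.
    handled : ∀ {D φ A rs p} → LiftsNeighbours φ → Known D φ A → Handled A rs p →
      Done D (φ p) ⊎ Any (Active (φ p)) (locate φ rs)
    handled {φ = φ} {rs = rs} lift known (inj₁ p∈) = inj₂ (locate-active φ rs p∈)
    handled {φ = φ} {p = p} lift known (inj₂ nbrs) = inj₁ done
      where
      done : Done _ (φ p)
      done b∈ b∈S with ∈-map⁻ φ (lift p b∈)
      ... | b′ , b′∈ , refl = known (All.lookup nbrs b′∈) b∈S

    Located-mono : ∀ {D D′} → (∀ {c} → c ∈ D → c ∈ D′) → ∀ {t} → Located D t → Located D′ t
    Located-mono D⊆D′ (lift , known) = lift , λ a∈ → D⊆D′ ∘ known a∈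

    -- The claimed set stays the same; the target becomes known because a cell of S outside `rem` is
    -- already claimed.
    reject-invariant : ∀ {t st rem D} → query t ∉ rem → Invariant (t ∷ st) rem D →
      Invariant (rejected t ++ st) rem D
    reject-invariant {i , φ} {st} {rem} {D} c∉rem inv = record
      { root∈D   = root∈D
      ; D⊆S      = D⊆S
      ; rem⊆S    = rem⊆S
      ; S⊆D∪rem  = S⊆D∪rem
      ; located  = All.++⁺ (locate-located lift known′ (proj₁ covers)) (All.tail located)
      ; frontier = frontier′ ∘ frontier
      }
      where
      open Invariant inv
      open Node (lookup i)
      covers = proj₁ (proj₂ (good i))
      lift = proj₁ (All.head located)
      known′ : Known D φ (target ∷ decided)
      known′ (here refl) c∈S = Sum.fromInj₁ (λ c∈rem → contradiction c∈rem c∉rem) (S⊆D∪rem c∈S)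
      known′ (there a∈)      = proj₂ (All.head located) a∈
      frontier′ : ∀ {d} → Done D d ⊎ Any (Active d) ((i , φ) ∷ st) →
        Done D d ⊎ Any (Active d) (locate φ reject ++ st)
      frontier′ (inj₁ done)       = inj₁ done
      frontier′ (inj₂ (there d∈)) = inj₂ (Any.++⁺ʳ _ d∈)
      frontier′ (inj₂ (here d∈)) with ∈-map⁻ φ d∈
      ... | a , a∈ , refl = Sum.map₂ Any.++⁺ˡ (handled {rs = reject} lift known′ (All.lookup (proj₂ covers) a∈))

    -- The new cell is both claimed and active, so the accepted parts must handle it too. The rest
    -- of the stack survives because `Known` and `Done` are monotone in D.
    accept-invariant : ∀ {t st rem rem′ D} →
      (∀ {c} → c ∈ rem′ → c ∈ rem) → (∀ {c} → c ∈ rem → c ≡ query t ⊎ c ∈ rem′) → query t ∈ rem →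
      Invariant (t ∷ st) rem D → Invariant (accepted t ++ st) rem′ (query t ∷ D)
    accept-invariant {t@(i , φ)} {st} {rem} {rem′} {D} rem′⊆rem rem⊆ c∈rem inv = record
      { root∈D   = there root∈D
      ; D⊆S      = λ { (here refl) → rem⊆S c∈rem ; (there d∈) → D⊆S d∈ }
      ; rem⊆S    = rem⊆S ∘ rem′⊆rem
      ; S⊆D∪rem  = λ c∈S → Sum.[ inj₁ ∘ there , Sum.map₁ here ∘ rem⊆ ] (S⊆D∪rem c∈S)
      ; located  = All.++⁺ (locate-located lift known′ (proj₁ covers))
                         (All.map (Located-mono there) (All.tail located))
      ; frontier = λ { (here refl) → active′ (here refl) ; (there d∈) → frontier′ (frontier d∈) }
      }
      where
      open Invariant inv
      open Node (lookup i)
      covers = proj₁ (good i)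
      lift = proj₁ (All.head located)
      D′ = query t ∷ D
      known′ : Known D′ φ (target ∷ decided)
      known′ (here refl) _ = here refl
      known′ (there a∈)    = there ∘ proj₂ (All.head located) a∈
      active′ : ∀ {a} → a ∈ target ∷ active → Done D′ (φ a) ⊎ Any (Active (φ a)) (locate φ accept ++ st)
      active′ a∈ = Sum.map₂ Any.++⁺ˡ (handled {rs = accept} lift known′ (All.lookup (proj₂ covers) a∈))
      frontier′ : ∀ {d} → Done D d ⊎ Any (Active d) (t ∷ st) →
        Done D′ d ⊎ Any (Active d) (locate φ accept ++ st)
      frontier′ (inj₁ done)       = inj₁ (λ b∈ → there ∘ done b∈)
      frontier′ (inj₂ (there d∈)) = inj₂ (Any.++⁺ʳ _ d∈)
      frontier′ (inj₂ (here d∈)) with ∈-map⁻ φ d∈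
      ... | a , a∈ , refl = active′ (there a∈)

    Exhibited : List (List Cell) → Set
    Exhibited = Any (λ X → ∀ c → c ∈ X ⇔ c ∈ S)

    -- Bounds the number of branchings still to come: an acceptance gives up one `bonus`, which
    -- exceeds the rank it adds.
    measure : ℕ → List Item → ℕ
    measure k st = k ℕ.* bonus ℕ.+ stackRank st

    measure-reject : ∀ {f} k t st → measure k (t ∷ st) ℕ.≤ suc f → measure k (rejected t ++ st) ℕ.≤ f
    measure-reject k (i , φ) st h = ℕ.s≤s⁻¹ (ℕ.<-≤-trans (begin-strict
      k ℕ.* bonus ℕ.+ stackRank (locate φ reject ++ st)
        ≡⟨ cong (k ℕ.* bonus ℕ.+_) (stackRank-locate φ reject st) ⟩
      k ℕ.* bonus ℕ.+ (ranks reject ℕ.+ stackRank st)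
        <⟨ ℕ.+-monoʳ-< (k ℕ.* bonus) (ℕ.+-monoˡ-< (stackRank st) (good-reject-rank i)) ⟩
      k ℕ.* bonus ℕ.+ (rank ℕ.+ stackRank st) ∎) h)
      where
      open Node (lookup i)
      open ℕ.≤-Reasoning

    measure-accept : ∀ {f} k t st → measure (suc k) (t ∷ st) ℕ.≤ suc f → measure k (accepted t ++ st) ℕ.≤ f
    measure-accept k (i , φ) st h = ℕ.s≤s⁻¹ (ℕ.<-≤-trans (begin-strict
      k ℕ.* bonus ℕ.+ stackRank (locate φ accept ++ st)
        ≡⟨ cong (k ℕ.* bonus ℕ.+_) (stackRank-locate φ accept st) ⟩
      k ℕ.* bonus ℕ.+ (ranks accept ℕ.+ stackRank st)
        <⟨ ℕ.+-monoʳ-< (k ℕ.* bonus) (ℕ.+-monoˡ-< (stackRank st) (good-accept-rank i)) ⟩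
      k ℕ.* bonus ℕ.+ (rank ℕ.+ bonus ℕ.+ stackRank st)
        ≡⟨ shuffle (k ℕ.* bonus) rank bonus (stackRank st) ⟩
      bonus ℕ.+ k ℕ.* bonus ℕ.+ (rank ℕ.+ stackRank st) ∎) h)
      where
      open Node (lookup i)
      open ℕ.≤-Reasoning
      shuffle : ∀ a r b s → a ℕ.+ (r ℕ.+ b ℕ.+ s) ≡ b ℕ.+ a ℕ.+ (r ℕ.+ s)
      shuffle = ℕ.solve-∀

    -- Membership of the target in `rem` selects the branch, so S itself traces a run. Once the
    -- stack is empty, no claimed cell has an unclaimed neighbour in S, and connectedness gives D =
    -- S.
    exhibit : ∀ f st k rem D → length rem ≡ k → Invariant st rem D → measure k st ℕ.≤ f →
      Exhibited (outcomes f st k D)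
    exhibit f [] k rem D _ inv _ = here λ c → mk⇔ D⊆S (closed⇒S⊆D root∈D done ∘ reach)
      where
      open Invariant inv
      done : ∀ {d} → d ∈ D → Done D d
      done d∈ with frontier d∈
      ... | inj₁ p = p
    -- The rank of a state exceeds that of its rejected parts, so it is positive and the measure
    -- cannot be 0.
    exhibit zero ((i , φ) ∷ st) k rem D _ inv h =
      contradiction (ℕ.<-≤-trans (good-reject-rank i)
        (ℕ.≤-trans (ℕ.≤-trans (ℕ.m≤m+n _ _) (ℕ.m≤n+m _ (k ℕ.* bonus))) h)) λ ()
    exhibit (suc f) (t ∷ st) zero [] D refl inv h =
      exhibit f _ zero [] D refl (reject-invariant (λ ()) inv) (measure-reject 0 t st h)
    exhibit (suc f) (t ∷ st) (suc k) rem D eq inv h with query t ∈? rem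
    ... | no  c∉ = Any.++⁺ʳ _
      (exhibit f _ (suc k) rem D eq (reject-invariant c∉ inv) (measure-reject (suc k) t st h))
    ... | yes c∈ with ys , zs , refl ← ∈-∃++ c∈ =
      Any.++⁺ˡ (exhibit f _ k (ys ++ zs) _ length≡
        (accept-invariant {t} widen narrow c∈ inv) (measure-accept k t st h))
      where
      length≡ : length (ys ++ zs) ≡ k
      length≡ = ℕ.suc-injective (begin
        suc (length (ys ++ zs))          ≡⟨ cong suc (List.length-++ ys) ⟩
        suc (length ys ℕ.+ length zs)    ≡⟨ ℕ.+-suc (length ys) (length zs) ⟨
        length ys ℕ.+ suc (length zs)    ≡⟨ List.length-++ ys ⟨
        length (ys ++ query t ∷ zs)      ≡⟨ eq ⟩
        suc k                            ∎)
        where open ≡-Reasoning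
      widen : ∀ {c} → c ∈ ys ++ zs → c ∈ ys ++ query t ∷ zs
      widen c∈ = Sum.[ ∈-++⁺ˡ , ∈-++⁺ʳ ys ∘ there ] (∈-++⁻ ys c∈)
      narrow : ∀ {c} → c ∈ ys ++ query t ∷ zs → c ≡ query t ⊎ c ∈ ys ++ zs
      narrow c∈ with ∈-++⁻ ys c∈
      ... | inj₁ c∈ys         = inj₂ (∈-++⁺ˡ c∈ys)
      ... | inj₂ (here c≡)    = inj₁ c≡
      ... | inj₂ (there c∈zs) = inj₂ (∈-++⁺ʳ ys c∈zs)

  -- From outcomes to the growth rate.

  module _ (active₀ : Node.active (lookup 0) ≡ origin ∷ [])
           (decided₀ : Node.decided (lookup 0) ≡ origin ∷ []) where

    initial : List Item
    initial = (0 , id) ∷ []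

    fuel : ℕ → ℕ
    fuel k = k ℕ.* bonus ℕ.+ stackRank initial

    candidates : ℕ → List (List Cell)
    candidates k = outcomes (fuel k) initial k (origin ∷ [])

    recentre-exhibited : ∀ {k} S → length S ≡ suc k → EdgeConnected S →
      Any (λ X → ∀ c → c ∈ X ⇔ c ∈ recentre S) (candidates k)
    recentre-exhibited {k} S@(r ∷ rs) eq connected =
      exhibit reach (fuel k) initial k (map τ rs) (origin ∷ [])
        (trans (List.length-map τ rs) (ℕ.suc-injective eq)) invariant ℕ.≤-refl
      where
      τ = translate (negate r)
      reach : ∀ {c} → c ∈ map τ S → Reach (map τ S) origin c
      reach c∈ with ∈-map⁻ τ c∈
      ... | d , d∈ , refl = subst (λ o → Reach (map τ S) o (τ d)) (translate-negate r)
                              (Reach-translate (negate r) (connected (here refl) d∈))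
      invariant : Invariant reach initial (map τ rs) (origin ∷ [])
      invariant = record
        { root∈D   = here refl
        ; D⊆S      = λ { (here refl) → here (sym (translate-negate r)) }
        ; rem⊆S    = there
        ; S⊆D∪rem  = λ { (here refl) → inj₁ (here (translate-negate r)) ; (there c∈) → inj₂ c∈ }
        ; located  = (id-lifts , λ a∈ _ → subst (λ A → _ ∈ A) decided₀ a∈) ∷ []
        ; frontier = λ { (here refl) →
            inj₂ (here (subst (λ P → origin ∈ map id P) (sym active₀) (here refl))) }
        }

    -- Each representative is sent to the position of an outcome that equals it, as a set, after
    -- recentring. Representatives sharing an outcome are translates, hence equal by `distinct`.
    count≤candidates : ∀ {k a} → PolyCount (suc k) a → a ℕ.≤ length (candidates k)
    count≤candidates {k} {a} (rep , polyomino , distinct , _) = Fin.injective⇒≤ {f = code} code-injective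
      where
      exhibited : ∀ i → Any (λ X → ∀ c → c ∈ X ⇔ c ∈ recentre (rep i)) (candidates k)
      exhibited i = recentre-exhibited (rep i) (proj₁ (proj₂ (polyomino i))) (proj₂ (proj₂ (polyomino i)))
      code : Fin a → Fin (length (candidates k))
      code i = Any.index (exhibited i)
      decoded : ∀ i c → c ∈ List.lookup (candidates k) (code i) ⇔ c ∈ recentre (rep i)
      decoded i = Any.lookup-index (exhibited i)
      code-injective : ∀ {i j} → code i ≡ code j → i ≡ j
      code-injective {i} {j} eq = distinct i j (recentre-translate (rep i) (rep j) λ c →
        mk⇔ (convert eq c) (convert (sym eq) c))
        where
        convert : ∀ {i j} → code i ≡ code j → ∀ c → c ∈ recentre (rep i) → c ∈ recentre (rep j)
        convert {i} {j} eq c = Equivalence.to (decoded j c) ∘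
          subst (λ x → c ∈ List.lookup (candidates k) x) eq ∘ Equivalence.from (decoded i c)

    count-bound : {{_ : ℕ.NonZero scale}} → q ℕ.≤ p → ∀ {k a} → PolyCount (suc k) a →
      a ℕ.* q ℕ.^ suc k ℕ.≤ Node.value (lookup 0) ℕ.* p ℕ.^ suc k
    count-bound q≤p {k} {a} count = begin
      a ℕ.* q ℕ.^ suc k
        ≤⟨ ℕ.*-monoˡ-≤ (q ℕ.^ suc k) (count≤candidates count) ⟩
      length (candidates k) ℕ.* q ℕ.^ suc k
        -- Omitting the division by `scale` only enlarges the constant factor.
        ≤⟨ ℕ.*-monoʳ-≤ (length (candidates k))
             (ℕ.m≤m*n (q ℕ.^ suc k) (stackScale initial) {{ℕ.m^n≢0 scale 1}}) ⟩
      length (candidates k) ℕ.* (q ℕ.^ suc k ℕ.* stackScale initial)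
        ≤⟨ length-outcomes q≤p (fuel k) initial k (origin ∷ []) ⟩
      stackValue initial ℕ.* p ℕ.^ suc k
        ≡⟨ cong (ℕ._* p ℕ.^ suc k) (ℕ.*-identityʳ (Node.value (lookup 0))) ⟩
      Node.value (lookup 0) ℕ.* p ℕ.^ suc k ∎
      where open ℕ.≤-Reasoning

    growth : {{_ : ℕ.NonZero scale}} → q ℕ.≤ p →
      ∀ {μ} → Positive μ → Positive (fromℕ q) → μ * fromℕ q ≡ fromℕ p →
      (A : ℕ → ℕ) → (∀ n → PolyCount n (A n)) →
      (ε : ℚ) → Positive ε → ∃[ N ] (∀ n → n ≥ N → fromℕ (A n) ≤ (μ + ε) ^ℚ n)
    -- The successor excludes n = 0: a run starts with the origin claimed, so n = k + 1.
    growth q≤p {μ} μ-pos q-pos μq≡p A count ε ε-pos = suc (proj₁ absorbed) , eventually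
      where
      absorbed = absorb-constant μ μ-pos ε ε-pos (Node.value (lookup 0))
      eventually : ∀ n → n ≥ suc (proj₁ absorbed) → fromℕ (A n) ≤ (μ + ε) ^ℚ n
      eventually n@(suc k) n≥N = begin
        fromℕ (A n)
          ≤⟨ clear-denominator μ q p q-pos μq≡p n (A n) (Node.value (lookup 0)) (count-bound q≤p (count n)) ⟩
        fromℕ (Node.value (lookup 0)) * μ ^ℚ n
          ≤⟨ proj₂ absorbed n (ℕ.≤-trans (ℕ.n≤1+n _) n≥N) ⟩
        (μ + ε) ^ℚ n ∎
        where open ℚ.≤-Reasoning

-- The table of states.

-- Decimal coding of the cells with coordinates below 10: 10 y + x stands for (x , y).
cell : ℕ → Cell
cell n = + (n ℕ.% 10) , + (n ℕ./ 10)

row : List ℕ → List ℕ → ℕ → ℕ → ℕ → List Part → List Part → Node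
row active known target = node (map cell active) (map cell known) (cell target)

start : Node
start = row (0 ∷ []) [] 1 59335 4
      -- After "yes" the two adjacent cells are explored separately, each with the other as a known
      -- cell; after "no" only the part of the origin remains.
      (part 1 1 1 2 ∷ part 1 3 2 0 ∷ []) (part 1 3 2 0 ∷ [])

-- Found numerically: for at most four active cells, and known cells next to them, the
-- branching cells and the groupings of the parts were chosen by minimising the resulting
-- growth rate, and states not needed for 4.5238 were then removed.  A branch with no parts
-- left after a rejection has the empty product 1.
table : List Node
table =
    start ∷
    row (11 ∷ []) (1 ∷ []) 21 14277 3
      (part 9 3 3 1 ∷ []) (part 2 1 1 3 ∷ []) ∷
    row (11 ∷ []) (10 ∷ 12 ∷ []) 1 6421 2
      (part 3 2 3 2 ∷ part 5 0 1 1 ∷ []) (part 5 0 1 1 ∷ []) ∷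
    row (11 ∷ []) (0 ∷ 1 ∷ 2 ∷ []) 21 6939 3
      (part 14 3 3 1 ∷ []) (part 6 3 3 1 ∷ []) ∷
    row (11 ∷ []) (1 ∷ 2 ∷ 10 ∷ []) 12 4151 2
      (part 12 0 1 1 ∷ []) (part 5 0 1 1 ∷ []) ∷
    row (11 ∷ []) (1 ∷ 10 ∷ 12 ∷ []) 21 2534 1
      (part 3 0 1 2 ∷ []) [] ∷
    row (11 ∷ []) (0 ∷ 10 ∷ 12 ∷ 20 ∷ []) 1 3678 2
      (part 4 5 1 2 ∷ part 8 0 1 1 ∷ []) (part 8 0 1 1 ∷ []) ∷
    row (11 ∷ []) (1 ∷ 2 ∷ 10 ∷ 20 ∷ []) 12 3254 2
      (part 21 0 1 1 ∷ []) (part 8 0 1 1 ∷ []) ∷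
    row (11 ∷ []) (1 ∷ 10 ∷ 12 ∷ 20 ∷ []) 21 1918 1
      (part 4 0 1 2 ∷ []) [] ∷
    row (11 ∷ 12 ∷ []) (10 ∷ []) 1 35538 5
      (part 10 0 1 1 ∷ part 3 2 3 2 ∷ []) (part 10 0 1 1 ∷ []) ∷
    row (11 ∷ 12 ∷ []) (1 ∷ 10 ∷ []) 13 14025 4
      (part 31 0 1 1 ∷ []) (part 13 0 1 1 ∷ []) ∷
    row (11 ∷ 12 ∷ []) (0 ∷ 1 ∷ 2 ∷ []) 10 12645 4
      (part 32 0 0 1 ∷ []) (part 12 0 1 1 ∷ []) ∷
    row (11 ∷ 12 ∷ []) (1 ∷ 2 ∷ 10 ∷ []) 21 7313 3
      (part 16 0 1 1 ∷ []) (part 4 4 2 1 ∷ []) ∷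
    row (11 ∷ 12 ∷ []) (1 ∷ 10 ∷ 13 ∷ []) 2 6369 3
      (part 4 5 2 2 ∷ part 19 0 1 1 ∷ []) (part 19 0 1 1 ∷ []) ∷
    row (11 ∷ 12 ∷ []) (0 ∷ 10 ∷ 20 ∷ []) 1 14752 5
      (part 34 1 1 3 ∷ []) (part 15 0 1 1 ∷ []) ∷
    row (11 ∷ 12 ∷ []) (1 ∷ 10 ∷ 20 ∷ []) 21 10101 4
      (part 16 4 1 1 ∷ []) (part 3 1 2 3 ∷ []) ∷
    row (12 ∷ 21 ∷ []) (2 ∷ 10 ∷ 11 ∷ []) 13 14304 4
      (part 35 0 1 1 ∷ []) (part 23 0 1 1 ∷ []) ∷
    row (12 ∷ 21 ∷ []) (2 ∷ 11 ∷ 20 ∷ []) 13 8558 3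
      (part 37 0 1 1 ∷ []) (part 24 0 1 1 ∷ []) ∷
    row (11 ∷ 12 ∷ []) (0 ∷ 1 ∷ 2 ∷ 3 ∷ []) 21 10042 4
      (part 39 0 1 1 ∷ []) (part 7 0 2 1 ∷ part 8 3 3 1 ∷ []) ∷
    row (11 ∷ 12 ∷ []) (1 ∷ 2 ∷ 10 ∷ 13 ∷ []) 21 3321 2
      (part 23 0 1 1 ∷ []) (part 8 0 2 1 ∷ []) ∷
    row (11 ∷ 12 ∷ []) (1 ∷ 2 ∷ 3 ∷ 10 ∷ []) 13 5758 3
      (part 38 0 1 1 ∷ []) (part 19 0 1 1 ∷ []) ∷
    row (11 ∷ 12 ∷ []) (1 ∷ 2 ∷ 10 ∷ 20 ∷ []) 21 6043 3
      (part 17 0 1 1 ∷ []) (part 4 4 2 1 ∷ []) ∷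
    row (12 ∷ 21 ∷ []) (2 ∷ 3 ∷ 10 ∷ 11 ∷ []) 13 11169 4
      (part 43 0 1 1 ∷ []) (part 23 0 1 1 ∷ []) ∷
    row (12 ∷ 21 ∷ []) (2 ∷ 10 ∷ 11 ∷ 13 ∷ []) 20 6346 3
      (part 45 2 4 4 ∷ []) (part 24 0 1 1 ∷ []) ∷
    row (12 ∷ 21 ∷ []) (2 ∷ 11 ∷ 13 ∷ 20 ∷ []) 31 3803 2
      (part 49 4 1 1 ∷ []) (part 28 0 1 1 ∷ []) ∷
    row (11 ∷ 12 ∷ []) (1 ∷ 2 ∷ 10 ∷ 13 ∷ 20 ∷ []) 21 2759 2
      (part 24 0 1 1 ∷ []) (part 8 0 2 1 ∷ []) ∷
    row (12 ∷ 21 ∷ []) (2 ∷ 10 ∷ 11 ∷ 13 ∷ 23 ∷ []) 20 5293 3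
      (part 54 2 4 4 ∷ []) (part 27 0 1 1 ∷ []) ∷
    row (12 ∷ 21 ∷ []) (2 ∷ 11 ∷ 13 ∷ 20 ∷ 23 ∷ []) 31 3145 2
      (part 56 4 1 1 ∷ []) (part 29 0 1 1 ∷ []) ∷
    row (12 ∷ 21 ∷ []) (2 ∷ 11 ∷ 13 ∷ 20 ∷ 31 ∷ []) 22 1720 1
      (part 7 0 2 2 ∷ []) [] ∷
    row (12 ∷ 21 ∷ []) (2 ∷ 11 ∷ 13 ∷ 20 ∷ 23 ∷ 31 ∷ []) 22 1424 1
      (part 8 0 2 2 ∷ []) [] ∷
    -- Deciding 22 completes the neighbourhoods of 12, 21 and 22, so neither answer leaves a part
    -- and the value is 1 + q / p, rounded up.
    row (12 ∷ 21 ∷ []) (2 ∷ 11 ∷ 13 ∷ 20 ∷ 23 ∷ 31 ∷ 32 ∷ []) 22 1222 1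
    [] [] ∷
    row (11 ∷ 12 ∷ 13 ∷ []) (1 ∷ 10 ∷ []) 2 34630 6
      (part 33 0 1 1 ∷ part 4 5 2 2 ∷ []) (part 33 0 1 1 ∷ []) ∷
    row (11 ∷ 12 ∷ 13 ∷ []) (1 ∷ 2 ∷ 3 ∷ []) 10 24120 5
      (part 57 7 5 1 ∷ []) (part 38 0 1 1 ∷ []) ∷
    row (11 ∷ 12 ∷ 13 ∷ []) (1 ∷ 2 ∷ 10 ∷ []) 21 18059 5
      (part 35 0 1 1 ∷ []) (part 15 0 2 1 ∷ []) ∷
    row (11 ∷ 12 ∷ 21 ∷ []) (0 ∷ 1 ∷ 2 ∷ []) 10 21038 5
      (part 36 0 0 1 ∷ []) (part 16 0 1 1 ∷ []) ∷
    row (12 ∷ 13 ∷ 21 ∷ []) (2 ∷ 10 ∷ 11 ∷ []) 23 35996 6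
      (part 61 2 5 4 ∷ []) (part 4 1 3 3 ∷ part 26 0 1 1 ∷ []) ∷
    row (11 ∷ 13 ∷ 22 ∷ []) (1 ∷ 3 ∷ 12 ∷ []) 21 30462 5
      (part 60 0 1 1 ∷ []) (part 5 3 3 1 ∷ part 17 0 2 1 ∷ []) ∷
    row (12 ∷ 13 ∷ 21 ∷ []) (2 ∷ 11 ∷ 20 ∷ []) 23 21509 5
      (part 62 2 5 4 ∷ []) (part 4 1 3 3 ∷ part 27 0 1 1 ∷ []) ∷
    row (11 ∷ 12 ∷ 13 ∷ []) (1 ∷ 2 ∷ 3 ∷ 10 ∷ []) 14 11022 4
      (part 63 0 1 1 ∷ []) (part 51 0 1 1 ∷ []) ∷
    row (11 ∷ 12 ∷ 21 ∷ []) (0 ∷ 1 ∷ 2 ∷ 3 ∷ []) 13 17192 5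
      (part 64 0 1 1 ∷ []) (part 41 0 1 1 ∷ []) ∷
    row (11 ∷ 12 ∷ 13 ∷ []) (1 ∷ 2 ∷ 10 ∷ 20 ∷ []) 21 14856 5
      (part 37 0 1 1 ∷ []) (part 15 0 2 1 ∷ []) ∷
    row (11 ∷ 12 ∷ 21 ∷ []) (0 ∷ 1 ∷ 2 ∷ 13 ∷ []) 31 9706 4
      (part 67 4 1 1 ∷ []) (part 52 0 1 1 ∷ []) ∷
    row (11 ∷ 12 ∷ 21 ∷ []) (3 ∷ 13 ∷ 22 ∷ 32 ∷ []) 2 14628 5
      (part 46 4 1 0 ∷ []) (part 18 3 3 1 ∷ []) ∷
    row (12 ∷ 13 ∷ 21 ∷ []) (2 ∷ 3 ∷ 10 ∷ 11 ∷ []) 22 21816 5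
      (part 46 2 5 4 ∷ []) (part 4 4 3 1 ∷ part 4 7 3 2 ∷ []) ∷
    row (12 ∷ 13 ∷ 21 ∷ []) (14 ∷ 22 ∷ 23 ∷ 32 ∷ []) 2 20661 5
      (part 75 6 5 4 ∷ []) (part 8 5 3 3 ∷ part 23 6 4 4 ∷ []) ∷
    row (12 ∷ 13 ∷ 21 ∷ []) (20 ∷ 22 ∷ 23 ∷ 31 ∷ []) 2 11503 4
      (part 77 6 5 4 ∷ []) (part 4 1 3 3 ∷ part 28 2 4 4 ∷ []) ∷
    row (12 ∷ 13 ∷ 21 ∷ []) (22 ∷ 23 ∷ 24 ∷ 31 ∷ []) 2 20742 5
      (part 76 6 5 4 ∷ []) (part 7 1 3 3 ∷ part 24 6 4 4 ∷ []) ∷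
    row (12 ∷ 13 ∷ 21 ∷ []) (22 ∷ 23 ∷ 30 ∷ 31 ∷ []) 20 21272 5
      (part 71 2 5 4 ∷ []) (part 45 0 1 1 ∷ []) ∷
    row (11 ∷ 13 ∷ 22 ∷ []) (0 ∷ 1 ∷ 3 ∷ 12 ∷ []) 10 24576 5
      (part 69 7 5 1 ∷ []) (part 50 0 1 1 ∷ []) ∷
    row (12 ∷ 13 ∷ 21 ∷ []) (2 ∷ 11 ∷ 20 ∷ 31 ∷ []) 23 9422 4
      (part 78 2 5 4 ∷ []) (part 4 1 3 3 ∷ part 29 0 1 1 ∷ []) ∷
    row (11 ∷ 13 ∷ 22 ∷ []) (1 ∷ 3 ∷ 10 ∷ 12 ∷ []) 21 13144 4
      (part 46 2 5 4 ∷ []) (part 17 0 2 1 ∷ []) ∷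
    row (11 ∷ 12 ∷ 13 ∷ []) (1 ∷ 2 ∷ 3 ∷ 10 ∷ 14 ∷ []) 21 5059 3
      (part 53 0 1 1 ∷ []) (part 25 0 2 1 ∷ []) ∷
    row (11 ∷ 12 ∷ 21 ∷ []) (0 ∷ 1 ∷ 2 ∷ 13 ∷ 31 ∷ []) 22 4744 3
      (part 7 0 2 2 ∷ part 25 3 3 1 ∷ []) (part 25 3 3 1 ∷ []) ∷
    row (12 ∷ 13 ∷ 21 ∷ []) (2 ∷ 3 ∷ 10 ∷ 11 ∷ 14 ∷ []) 22 10403 4
      (part 55 2 5 4 ∷ []) (part 4 7 3 2 ∷ part 8 0 3 1 ∷ []) ∷
    row (12 ∷ 13 ∷ 21 ∷ []) (10 ∷ 20 ∷ 22 ∷ 23 ∷ 31 ∷ []) 2 9716 4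
      (part 81 6 5 4 ∷ []) (part 4 1 3 3 ∷ part 29 2 4 4 ∷ []) ∷
    row (12 ∷ 13 ∷ 21 ∷ []) (20 ∷ 22 ∷ 23 ∷ 24 ∷ 31 ∷ []) 11 11042 4
      (part 4 2 3 3 ∷ part 20 5 2 3 ∷ []) (part 20 5 2 3 ∷ []) ∷
    row (12 ∷ 13 ∷ 21 ∷ []) (2 ∷ 11 ∷ 20 ∷ 31 ∷ 32 ∷ []) 23 7784 4
      (part 83 2 5 4 ∷ []) (part 4 1 3 3 ∷ part 30 0 1 1 ∷ []) ∷
    row (11 ∷ 12 ∷ 13 ∷ 14 ∷ []) (1 ∷ 2 ∷ 3 ∷ []) 23 59249 7
      (part 66 7 6 1 ∷ []) (part 3 1 4 3 ∷ part 21 7 4 1 ∷ []) ∷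
    row (12 ∷ 21 ∷ 23 ∷ 32 ∷ []) (2 ∷ 11 ∷ 22 ∷ []) 13 58414 6
      (part 36 0 1 2 ∷ part 4 1 3 3 ∷ []) (part 36 0 1 2 ∷ []) ∷
    row (11 ∷ 12 ∷ 13 ∷ 22 ∷ []) (10 ∷ 21 ∷ 31 ∷ []) 2 34335 6
      (part 58 1 1 4 ∷ []) (part 8 2 3 3 ∷ part 22 4 2 1 ∷ []) ∷
    row (11 ∷ 13 ∷ 21 ∷ 22 ∷ []) (1 ∷ 3 ∷ 12 ∷ []) 10 39699 6
      (part 73 7 5 1 ∷ []) (part 46 2 5 4 ∷ []) ∷
    row (11 ∷ 13 ∷ 21 ∷ 22 ∷ []) (23 ∷ 24 ∷ 32 ∷ []) 12 63444 7
      (part 65 0 1 1 ∷ []) (part 4 5 3 3 ∷ part 11 6 3 4 ∷ []) ∷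
    row (11 ∷ 13 ∷ 21 ∷ 22 ∷ []) (14 ∷ 23 ∷ 32 ∷ []) 12 38243 6
      (part 68 0 1 1 ∷ []) (part 5 2 5 3 ∷ part 11 6 3 4 ∷ []) ∷
    row (11 ∷ 12 ∷ 13 ∷ 14 ∷ []) (1 ∷ 2 ∷ 3 ∷ 10 ∷ []) 22 26971 6
      (part 70 0 1 1 ∷ []) (part 8 7 3 1 ∷ part 15 0 3 1 ∷ []) ∷
    row (11 ∷ 12 ∷ 13 ∷ 21 ∷ []) (0 ∷ 1 ∷ 2 ∷ 3 ∷ []) 22 33861 6
      (part 60 0 1 1 ∷ []) (part 4 4 3 1 ∷ part 21 3 3 1 ∷ []) ∷
    row (11 ∷ 12 ∷ 13 ∷ 21 ∷ []) (22 ∷ 23 ∷ 24 ∷ 32 ∷ []) 2 49555 7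
      (part 79 0 1 0 ∷ []) (part 7 1 3 3 ∷ part 18 3 3 1 ∷ []) ∷
    row (11 ∷ 13 ∷ 14 ∷ 22 ∷ []) (2 ∷ 3 ∷ 4 ∷ 12 ∷ []) 23 78333 7
      (part 73 7 6 1 ∷ []) (part 4 4 4 1 ∷ part 16 3 4 1 ∷ []) ∷
    row (11 ∷ 12 ∷ 13 ∷ 21 ∷ []) (0 ∷ 10 ∷ 20 ∷ 31 ∷ []) 22 22446 6
      (part 59 0 1 1 ∷ []) (part 40 5 1 3 ∷ []) ∷
    row (11 ∷ 12 ∷ 13 ∷ 21 ∷ []) (14 ∷ 22 ∷ 23 ∷ 32 ∷ []) 3 28050 6
      (part 74 4 1 0 ∷ []) (part 42 0 1 1 ∷ []) ∷
    row (11 ∷ 13 ∷ 14 ∷ 22 ∷ []) (1 ∷ 3 ∷ 4 ∷ 12 ∷ []) 23 51715 6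
      (part 17 0 3 1 ∷ part 17 3 4 1 ∷ []) (part 4 4 4 1 ∷ part 17 3 4 1 ∷ []) ∷
    row (11 ∷ 13 ∷ 14 ∷ 22 ∷ []) (1 ∷ 3 ∷ 10 ∷ 12 ∷ []) 21 34366 6
      (part 72 0 1 1 ∷ []) (part 37 0 2 1 ∷ []) ∷
    row (13 ∷ 14 ∷ 21 ∷ 22 ∷ []) (3 ∷ 4 ∷ 11 ∷ 12 ∷ []) 23 44191 6
      (part 17 0 3 1 ∷ part 12 7 4 2 ∷ []) (part 4 4 4 1 ∷ part 12 7 4 2 ∷ []) ∷
    row (13 ∷ 14 ∷ 21 ∷ 22 ∷ []) (3 ∷ 10 ∷ 11 ∷ 12 ∷ []) 23 58162 7
      (part 16 4 3 1 ∷ part 20 7 4 2 ∷ []) (part 3 1 4 3 ∷ part 20 7 4 2 ∷ []) ∷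
    row (11 ∷ 14 ∷ 22 ∷ 23 ∷ []) (1 ∷ 3 ∷ 12 ∷ 13 ∷ []) 21 85755 7
      (part 12 3 3 1 ∷ part 44 2 6 4 ∷ []) (part 5 3 3 1 ∷ part 44 2 6 4 ∷ []) ∷
    row (12 ∷ 13 ∷ 22 ∷ 31 ∷ []) (23 ∷ 24 ∷ 32 ∷ 42 ∷ []) 21 60718 7
      (part 46 0 1 1 ∷ part 4 3 3 3 ∷ []) (part 4 3 3 3 ∷ part 18 2 5 3 ∷ []) ∷
    row (12 ∷ 22 ∷ 23 ∷ 31 ∷ []) (2 ∷ 11 ∷ 20 ∷ 21 ∷ []) 32 38404 6
      (part 50 4 2 1 ∷ part 4 7 3 3 ∷ []) (part 4 7 3 3 ∷ part 23 1 2 4 ∷ []) ∷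
    row (12 ∷ 22 ∷ 23 ∷ 31 ∷ []) (1 ∷ 11 ∷ 21 ∷ 30 ∷ []) 32 37847 6
      (part 80 6 5 5 ∷ []) (part 5 0 1 3 ∷ part 22 1 2 4 ∷ []) ∷
    row (12 ∷ 22 ∷ 23 ∷ 31 ∷ []) (11 ∷ 21 ∷ 30 ∷ 41 ∷ []) 32 19737 5
      (part 48 1 2 5 ∷ []) (part 16 1 2 4 ∷ []) ∷
    row (11 ∷ 13 ∷ 21 ∷ 22 ∷ []) (3 ∷ 14 ∷ 23 ∷ 32 ∷ []) 12 15879 5
      (part 42 0 1 1 ∷ []) (part 11 6 3 4 ∷ []) ∷
    row (12 ∷ 21 ∷ 23 ∷ 31 ∷ []) (22 ∷ 32 ∷ 33 ∷ 34 ∷ 42 ∷ []) 11 76353 7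
      (part 20 3 3 2 ∷ part 47 7 5 1 ∷ []) (part 20 3 3 2 ∷ part 17 1 2 4 ∷ []) ∷
    row (12 ∷ 21 ∷ 23 ∷ 31 ∷ []) (22 ∷ 32 ∷ 33 ∷ 34 ∷ 41 ∷ []) 30 43178 6
      (part 82 0 0 1 ∷ []) (part 48 2 5 4 ∷ []) ∷
    row (12 ∷ 22 ∷ 23 ∷ 31 ∷ []) (11 ∷ 21 ∷ 30 ∷ 41 ∷ 42 ∷ []) 32 17210 5
      (part 50 1 2 5 ∷ []) (part 16 1 2 4 ∷ []) ∷
    row (13 ∷ 22 ∷ 24 ∷ 31 ∷ []) (23 ∷ 32 ∷ 34 ∷ 35 ∷ 42 ∷ []) 12 84150 7
      (part 23 6 4 5 ∷ part 47 7 6 1 ∷ []) (part 23 6 4 5 ∷ part 17 1 3 4 ∷ []) ∷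
    row (11 ∷ 13 ∷ 21 ∷ 22 ∷ []) (2 ∷ 3 ∷ 14 ∷ 23 ∷ 32 ∷ []) 12 12262 5
      (part 18 3 3 1 ∷ []) (part 18 3 3 1 ∷ []) ∷
    []

-- Checking the table and concluding.

entry : Node → List Node → ℕ → Node
-- Indices beyond the table give the default, which is why `entry⁺` also asks for `P d`.
entry d []       _       = d
entry d (n ∷ ns) zero    = n
entry d (n ∷ ns) (suc i) = entry d ns i

entry⁺ : ∀ {P : Node → Set} {d ns} → P d → All P ns → ∀ i → P (entry d ns i)
entry⁺ Pd []         i       = Pd
entry⁺ Pd (Pn ∷ _)   zero    = Pn
entry⁺ Pd (_  ∷ Pns) (suc i) = entry⁺ Pd Pns i

parameters : Parameters
-- p / q is `bound`, and the values in the table are thousandths.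
parameters = record { lookup = entry start table ; p = 45238 ; q = 10000 ; scale = 1000 ; bonus = 3 }

open Conditions parameters using (Good; good?)

table-good : ∀ i → Good (entry start table i)
table-good = entry⁺ {Good} {start} {table}
  (toWitness {a? = good? start} tt) (toWitness {a? = all? good? table} tt)

theorem1 : (A : ℕ → ℕ) → (∀ n → PolyCount n (A n)) →
    (ε : ℚ) → Positive ε →
    ∃[ N ] (∀ n → n ≥ N → (+ A n / 1) ≤ ((bound + ε) ^ℚ n))
-- The equations closed by `refl` say that state 0 is the bare origin and that `bound` times 10000
-- is 45238.
theorem1 = Exploration.growth parameters table-good refl refl
  (toWitness {a? = 10000 ℕ.≤? 45238} tt) {bound} _ _ refl
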